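{- Let $\alpha_i\ge 0$, $\beta_i>0$ ($1\le i\le 5$) and $Q>0$ be real numbers, and consider the networks $N$ and $N^+$ with these parameters and total flow $Q$. Suppose that at equilibria $N$ has no path with vanishing flow and $P_1$ is the only path with vanishing flow in $N^+$. Then Braess' paradox occurs in $N/N^+$ (i.e. $T^+_{Eq}>T_{Eq}$) if and only if $\mathcal B_3>0$ and $$\max\left\{\frac{\alpha}{\beta_{12}},\ \frac{ -\alpha}{\beta_{45}},\ \frac{\bar\alpha}{\beta_{13}},\ \frac{ -\bar\alpha}{\beta_4},\ \frac{\bar\alpha\beta_4\beta-\alpha\beta_{134}\beta_{45}}{\mathcal B_3}\right\} < Q \le \mu_1.$$
   Context: The network $N^+$ has nodes $a,b,c,d$ and directed links $(a,b),(b,d),(b,c),(a,c),(c,d)$ with travel times $\alpha_1+\beta_1f_{ab}$, $\alpha_2+\beta_2f_{bd}$, $\alpha_3+\beta_3f_{bc}$, $\alpha_4+\beta_4f_{ac}$, $\alpha_5+\beta_5f_{cd}$ respectively, where $f_{ij}\ge 0$ is the (real) flow on link $(i,j)$ and $\alpha_i\ge 0$, $\beta_i>0$. All traffic, of total amount $Q>0$ (real), goes from $a$ to $d$ along the paths $P_1=a-b-d$, $P_2=a-c-d$, $P_3=a-b-c-d$. The network $N$ is $N^+$ with the link $(b,c)$ removed, so its paths are $P_1,P_2$ only. A flow assigns a non-negative real amount to each path, with total $Q$; the flow on a link is the sum of the flows of the paths containing it; the travel time on a path is the sum of the travel times of its links. A path has vanishing flow if its path flow is $0$, and non-vanishing flow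 otherwise. A network is at equilibrium if all paths with non-vanishing flow have the same travel time, and every path with vanishing flow has travel time at least this common value. The equilibrium exists and is unique; its common travel time is denoted $T_{Eq}$ for $N$ and $T^+_{Eq}$ for $N^+$. Braess' paradox is said to occur in $N/N^+$ for the total flow $Q$ if $T^+_{Eq}>T_{Eq}$. Notation: multiple indices denote sums, e.g. $\alpha_{ij}=\alpha_i+\alpha_j$, $\beta_{134}=\beta_1+\beta_3+\beta_4$. Further, $\alpha=\alpha_{45}-\alpha_{12}$, $\bar\alpha=\alpha_4-\alpha_{13}$, $\hat\alpha=\alpha_2-\alpha_{35}$, $\beta=\beta_1+\beta_2+\beta_4+\beta_5$, $\mathcal B_3=\beta_{45}^2\beta_{134}-\beta_4^2\beta$, and $$\mu_1=\frac{\hat\alpha\beta_{14}-\alpha\beta_3}{\beta_3\beta_{45}+\beta_5\beta_{14}}.$$ -}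

module Defs where

open import Algebra.Apartness.Bundles using (HeytingField; HeytingCommutativeRing)
open import Algebra.Bundles using (CommutativeRing)
import Algebra.Definitions.RawMonoid as RawMonoidDefinitions
open import Data.Fin.Base using (Fin)
open import Data.Fin.Patterns using (0F; 1F; 2F; 3F; 4F)
open import Data.Fin.Properties using (_≟_)
open import Data.List.Base using (List; []; _∷_; map; filter; foldr)
import Data.List.Membership.DecPropositional as DecMembership
open import Data.Nat.Base as ℕ using (ℕ)
open import Data.Product.Base using (_×_; ∃-syntax; Σ-syntax; proj₁)
open import Data.Sum.Base using (_⊎_; inj₂)
open import Function.Bundles using (_⇔_; Equivalence)
open import Level using (Level) renaming (suc to lsuc; _⊔_ to _⊔ˡ_)
open import Relation.Binary.Core using (Rel)
open import Relation.Binary.Lattice.Definitions using (Supremum)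
open import Relation.Binary.PropositionalEquality.Core using (_≡_; _≢_)
open import Relation.Binary.Structures using (IsStrictPartialOrder)
open import Relation.Nullary.Negation.Core using (¬_)

open DecMembership (_≟_ {5}) using (_∈?_)

-- A system of real numbers: an Archimedean, Cauchy-complete ordered field.
-- Classically this determines ℝ up to unique isomorphism.  Trichotomy is not
-- assumed, so that Bishop's constructive reals are an instance as well;
-- x # y is "x ≠ y" in the form suited to such a field.
record RealNumbers (c ℓ₁ ℓ₂ : Level) : Set (lsuc (c ⊔ˡ ℓ₁ ⊔ˡ ℓ₂)) where
  field
    heytingField : HeytingField c ℓ₁ ℓ₂

  open HeytingField heytingField public

  commutativeRing : CommutativeRing c ℓ₁
  commutativeRing =
    HeytingCommutativeRing.commutativeRing
      (HeytingField.heytingCommutativeRing heytingField)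

  open RawMonoidDefinitions (CommutativeRing.+-rawMonoid commutativeRing) public
    using () renaming (_×_ to _·_)

  infix  4 _<_ _≤_
  infixl 5 _⊔_

  field
    _<_                  : Rel Carrier ℓ₂
    isStrictPartialOrder : IsStrictPartialOrder _≈_ _<_
    #⇔<⊎>                : ∀ {x y} → x # y ⇔ (x < y ⊎ y < x)
    +-monoˡ-<            : ∀ {x y} z → x < y → x + z < y + z
    *-pos                : ∀ {x y} → 0# < x → 0# < y → 0# < x * y

  _≤_ : Rel Carrier ℓ₂
  x ≤ y = ¬ (y < x)

  IsCauchy : (ℕ → Carrier) → Set (c ⊔ˡ ℓ₂)
  IsCauchy s = ∀ ε → 0# < ε →
    ∃[ k ] (∀ m n → k ℕ.≤ m → k ℕ.≤ n → s m < s n + ε)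

  _ConvergesTo_ : (ℕ → Carrier) → Carrier → Set (c ⊔ˡ ℓ₂)
  s ConvergesTo l = ∀ ε → 0# < ε →
    ∃[ k ] (∀ n → k ℕ.≤ n → s n < l + ε × l < s n + ε)

  field
    _⊔_         : Carrier → Carrier → Carrier
    ⊔-supremum  : Supremum _≤_ _⊔_
    archimedean : ∀ x → ∃[ n ] x < n · 1#
    complete    : ∀ s → IsCauchy s → ∃[ l ] s ConvergesTo l

  open IsStrictPartialOrder isStrictPartialOrder public
    using (<-respʳ-≈; <-respˡ-≈; <-resp-≈)
    renaming (trans to <-trans; irrefl to <-irrefl)

  +-pos : ∀ {x y} → 0# < x → 0# < y → 0# < x + y
  +-pos {x} {y} 0<x 0<y =
    <-trans 0<y (<-respˡ-≈ (+-identityˡ y) (+-monoˡ-< y 0<x))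

  pos⇒#0 : ∀ {x} → 0# < x → x # 0#
  pos⇒#0 0<x = Equivalence.from #⇔<⊎> (inj₂ 0<x)

  -- #⇒invertible y#0 inverts y - 0#, which is ≈ y.
  infixl 7 _/_[_]
  _/_[_] : Carrier → (y : Carrier) → 0# < y → Carrier
  x / y [ 0<y ] = x * proj₁ (#⇒invertible (pos⇒#0 0<y))

data Network : Set where
  N N⁺ : Network

-- In the order of the indices of αᵢ and βᵢ.
Link : Set
Link = Fin 5

pattern ab = 0F
pattern bd = 1F
pattern bc = 2F
pattern ac = 3F
pattern cd = 4F

data Path : Network → Set where
  P₁ P₂ : ∀ {net} → Path net
  P₃    : Path N⁺

paths : ∀ net → List (Path net)
paths N  = P₁ ∷ P₂ ∷ []
paths N⁺ = P₁ ∷ P₂ ∷ P₃ ∷ []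

links : ∀ {net} → Path net → List Link
links P₁ = ab ∷ bd ∷ []
links P₂ = ac ∷ cd ∷ []
links P₃ = ab ∷ bc ∷ cd ∷ []

module Braess {c ℓ₁ ℓ₂} (ℝ : RealNumbers c ℓ₁ ℓ₂) where

  open RealNumbers ℝ

  sum : List Carrier → Carrier
  sum = foldr _+_ 0#

  -- The travel time on link i is constant i + slope i * (flow on i).
  record Parameters : Set (c ⊔ˡ ℓ₂) where
    field
      constant   : Link → Carrier
      slope      : Link → Carrier
      Q          : Carrier
      constant≥0 : ∀ i → 0# ≤ constant i
      slope>0    : ∀ i → 0# < slope i
      Q>0        : 0# < Q

  module _ (params : Parameters) where

    open Parameters params

    record Flow (net : Network) : Set (c ⊔ˡ ℓ₁ ⊔ˡ ℓ₂) where
      field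
        flow   : Path net → Carrier
        flow≥0 : ∀ p → 0# ≤ flow p
        total  : sum (map flow (paths net)) ≈ Q

      linkFlow : Link → Carrier
      linkFlow i = sum (map flow (filter (λ p → i ∈? links p) (paths net)))

      linkTime : Link → Carrier
      linkTime i = constant i + slope i * linkFlow i

      pathTime : Path net → Carrier
      pathTime p = sum (map linkTime (links p))

      Vanishing : Path net → Set ℓ₁
      Vanishing p = flow p ≈ 0#

      NonVanishing : Path net → Set ℓ₂
      NonVanishing p = flow p # 0#

    -- As the total flow is positive, some path has non-vanishing flow, so the
    -- flow determines its equilibrium time.
    record Equilibrium (net : Network) : Set (c ⊔ˡ ℓ₁ ⊔ˡ ℓ₂) where
      field
        equilibriumFlow : Flow net
        time            : Carrier

      open Flow equilibriumFlow public

      field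
        nonVanishing-time : ∀ p → NonVanishing p → pathTime p ≈ time
        vanishing-time    : ∀ p → Vanishing p → time ≤ pathTime p

    open Equilibrium using (time)

    NoVanishingPath : ∀ {net} → Equilibrium net → Set ℓ₂
    NoVanishingPath E = ∀ p → Equilibrium.NonVanishing E p

    OnlyVanishingPath : ∀ {net} → Equilibrium net → Path net → Set (ℓ₁ ⊔ˡ ℓ₂)
    OnlyVanishingPath E p =
      Equilibrium.Vanishing E p × (∀ q → q ≢ p → Equilibrium.NonVanishing E q)

    BraessParadox : Equilibrium N → Equilibrium N⁺ → Set ℓ₂
    BraessParadox E E⁺ = time E < time E⁺

  module Notation (params : Parameters) where

    open Parameters params public using (Q)
    open Parameters params using (constant; slope; slope>0)

    α₁ α₂ α₃ α₄ α₅ : Carrier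
    α₁ = constant ab
    α₂ = constant bd
    α₃ = constant bc
    α₄ = constant ac
    α₅ = constant cd

    β₁ β₂ β₃ β₄ β₅ : Carrier
    β₁ = slope ab
    β₂ = slope bd
    β₃ = slope bc
    β₄ = slope ac
    β₅ = slope cd

    α₁₂ α₁₃ α₃₅ α₄₅ : Carrier
    α₁₂ = α₁ + α₂
    α₁₃ = α₁ + α₃
    α₃₅ = α₃ + α₅
    α₄₅ = α₄ + α₅

    β₁₂ β₁₃ β₁₄ β₄₅ β₁₃₄ : Carrier
    β₁₂  = β₁ + β₂
    β₁₃  = β₁ + β₃
    β₁₄  = β₁ + β₄
    β₄₅  = β₄ + β₅
    β₁₃₄ = β₁ + β₃ + β₄

    α ᾱ α̂ β : Carrier
    α = α₄₅ - α₁₂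
    ᾱ = α₄ - α₁₃
    α̂ = α₂ - α₃₅
    β = β₁ + β₂ + β₄ + β₅

    𝓑₃ : Carrier
    𝓑₃ = β₄₅ * β₄₅ * β₁₃₄ - β₄ * β₄ * β

    0<β₄ : 0# < β₄
    0<β₄ = slope>0 ac

    0<β₁₂ : 0# < β₁₂
    0<β₁₂ = +-pos (slope>0 ab) (slope>0 bd)

    0<β₁₃ : 0# < β₁₃
    0<β₁₃ = +-pos (slope>0 ab) (slope>0 bc)

    0<β₁₄ : 0# < β₁₄
    0<β₁₄ = +-pos (slope>0 ab) (slope>0 ac)

    0<β₄₅ : 0# < β₄₅
    0<β₄₅ = +-pos (slope>0 ac) (slope>0 cd)

    0<β₃β₄₅+β₅β₁₄ : 0# < β₃ * β₄₅ + β₅ * β₁₄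
    0<β₃β₄₅+β₅β₁₄ =
      +-pos (*-pos (slope>0 bc) 0<β₄₅) (*-pos (slope>0 cd) 0<β₁₄)

    μ₁ : Carrier
    μ₁ = (α̂ * β₁₄ - α * β₃) / (β₃ * β₄₅ + β₅ * β₁₄) [ 0<β₃β₄₅+β₅β₁₄ ]

{-# OPTIONS --safe #-}

-- At equilibrium all path times are affine in Q, and solving for the flows of
-- the used paths turns f > 0 into the first four bounds on Q, the time of the
-- unused path P₁ into Q ≤ μ₁, and T⁺ - T into a positive multiple of
-- Q 𝓑₃ - (ᾱβ₄β - αβ₁₃₄β₄₅).  What remains is that the paradox forces 𝓑₃ > 0:
-- with T₁⁺ ≥ T⁺ the time of P₁ in N⁺ and f₁ > 0 its flow in N,
-- β₁(T⁺ - T) + β₄(T₁⁺ - T) = f₁(β₁β₅ - β₂β₄), so β₁β₅ > β₂β₄, and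
-- 𝓑₃ - β₄(β₁β₅ - β₂β₄) is a polynomial in the β's with positive coefficients.

module Submission where

open import Defs
open import Algebra.Apartness.Bundles using (HeytingField)
import Algebra.Apartness.Properties.HeytingCommutativeRing as HeytingProperties
open import Algebra.Bundles using (CommutativeRing; RawRing)
import Algebra.Properties.AbelianGroup as AbelianGroupProperties
import Algebra.Properties.Ring as RingProperties
import Algebra.Properties.Semiring.Mult.TCOptimised as Multiples
import Algebra.Solver.Ring as RingSolver
open import Algebra.Solver.Ring.AlmostCommutativeRing
  using (fromCommutativeRing; _-Raw-AlmostCommutative⟶_)
open import Data.Empty using (⊥-elim)
open import Data.Integer.Base as ℤ using (ℤ; +_; -[1+_])
import Data.Integer.Properties as ℤ
open import Data.Maybe.Base using (Maybe; map)
open import Data.Nat.Base as ℕ using (zero; suc)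
import Data.Nat.Properties as ℕ
open import Data.Product.Base using (_×_; Σ-syntax; _,_; proj₁; proj₂)
open import Data.Sum.Base using (_⊎_; inj₁; inj₂; [_,_]′)
open import Function.Base using (_∘_; id)
open import Function.Bundles using (_⇔_; mk⇔; Equivalence)
open import Relation.Binary.PropositionalEquality.Core as ≡ using (_≡_; _≢_)
import Relation.Binary.Reasoning.Setoid as ≈-Reasoning
open import Relation.Nullary.Decidable.Core using (dec⇒maybe)
open import Relation.Nullary.Negation.Core using (¬_)

-- A ring solver with integer coefficients.

module IntegerCoefficients {c ℓ} (R : CommutativeRing c ℓ) where

  open CommutativeRing R
  open RingProperties ring using (-‿involutive; -‿distribˡ-*; -‿distribʳ-*; -0#≈0#)
  open AbelianGroupProperties +-abelianGroup using (⁻¹-∙-comm)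
  open Multiples semiring using (1+×; ×-homo-+; ×1-homo-*) renaming (_×_ to _·_)
  open ≈-Reasoning setoid

  -- With these multiples `0 · 1#` and `1 · 1#` reduce to `0#` and `1#`, so `con (+ 0)` in a solver
  -- call matches a literal `0#`.
  ⟦_⟧ℤ : ℤ → Carrier
  ⟦ + n ⟧ℤ      = n · 1#
  ⟦ -[1+ n ] ⟧ℤ = - (suc n · 1#)

  [x+y]-[x+z]≈y-z : ∀ x y z → (x + y) - (x + z) ≈ y - z
  [x+y]-[x+z]≈y-z x y z = begin
    (x + y) - (x + z)     ≈⟨ +-cong (+-comm x y) (sym (⁻¹-∙-comm x z)) ⟩
    (y + x) + (- x - z)   ≈⟨ +-assoc y x (- x - z) ⟩
    y + (x + (- x - z))   ≈⟨ +-congˡ (+-assoc x (- x) (- z)) ⟨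
    y + ((x - x) - z)     ≈⟨ +-congˡ (+-congʳ (-‿inverseʳ x)) ⟩
    y + (0# - z)          ≈⟨ +-congˡ (+-identityˡ (- z)) ⟩
    y - z                 ∎

  ⊖-homo : ∀ m n → ⟦ m ℤ.⊖ n ⟧ℤ ≈ m · 1# - n · 1#
  ⊖-homo zero    zero    = sym (-‿inverseʳ 0#)
  ⊖-homo zero    (suc n) = sym (+-identityˡ _)
  ⊖-homo (suc m) zero    = sym (trans (+-congˡ -0#≈0#) (+-identityʳ _))
  ⊖-homo (suc m) (suc n) = begin
    ⟦ suc m ℤ.⊖ suc n ⟧ℤ              ≡⟨ ≡.cong ⟦_⟧ℤ (ℤ.[1+m]⊖[1+n]≡m⊖n m n) ⟩
    ⟦ m ℤ.⊖ n ⟧ℤ                      ≈⟨ ⊖-homo m n ⟩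
    m · 1# - n · 1#                   ≈⟨ [x+y]-[x+z]≈y-z 1# (m · 1#) (n · 1#) ⟨
    (1# + m · 1#) - (1# + n · 1#)     ≈⟨ +-cong (1+× m 1#) (-‿cong (1+× n 1#)) ⟨
    suc m · 1# - suc n · 1#           ∎

  ℤ-+-homo : ∀ i j → ⟦ i ℤ.+ j ⟧ℤ ≈ ⟦ i ⟧ℤ + ⟦ j ⟧ℤ
  ℤ-+-homo (+ m)    (+ n)    = ×-homo-+ 1# m n
  ℤ-+-homo (+ m)    -[1+ n ] = ⊖-homo m (suc n)
  ℤ-+-homo -[1+ m ] (+ n)    = trans (⊖-homo n (suc m)) (+-comm _ _)
  ℤ-+-homo -[1+ m ] -[1+ n ] = begin
    - (suc (suc (m ℕ.+ n)) · 1#)        ≡⟨ ≡.cong (λ k → - (suc k · 1#)) (ℕ.+-suc m n) ⟨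
    - ((suc m ℕ.+ suc n) · 1#)          ≈⟨ -‿cong (×-homo-+ 1# (suc m) (suc n)) ⟩
    - (suc m · 1# + suc n · 1#)         ≈⟨ ⁻¹-∙-comm _ _ ⟨
    - (suc m · 1#) - suc n · 1#         ∎

  ℤ-neg-homo : ∀ i → ⟦ ℤ.- i ⟧ℤ ≈ - ⟦ i ⟧ℤ
  ℤ-neg-homo (+ zero)  = sym -0#≈0#
  ℤ-neg-homo (+ suc n) = refl
  ℤ-neg-homo -[1+ n ]  = sym (-‿involutive _)

  ℤ-*-homo-+ : ∀ i n → ⟦ i ℤ.* (+ n) ⟧ℤ ≈ ⟦ i ⟧ℤ * (n · 1#)
  ℤ-*-homo-+ (+ m) n = begin
    ⟦ (+ m) ℤ.* (+ n) ⟧ℤ            ≡⟨ ≡.cong ⟦_⟧ℤ (ℤ.pos-* m n) ⟨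
    (m ℕ.* n) · 1#                  ≈⟨ ×1-homo-* m n ⟩
    (m · 1#) * (n · 1#)             ∎
  ℤ-*-homo-+ -[1+ m ] n = begin
    ⟦ -[1+ m ] ℤ.* (+ n) ⟧ℤ         ≡⟨ ≡.cong ⟦_⟧ℤ (ℤ.neg-distribˡ-* (+ suc m) (+ n)) ⟨
    ⟦ ℤ.- ((+ suc m) ℤ.* (+ n)) ⟧ℤ  ≈⟨ ℤ-neg-homo ((+ suc m) ℤ.* (+ n)) ⟩
    - ⟦ (+ suc m) ℤ.* (+ n) ⟧ℤ      ≈⟨ -‿cong (ℤ-*-homo-+ (+ suc m) n) ⟩
    - ((suc m · 1#) * (n · 1#))     ≈⟨ -‿distribˡ-* _ _ ⟩
    - (suc m · 1#) * (n · 1#)       ∎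

  ℤ-*-homo : ∀ i j → ⟦ i ℤ.* j ⟧ℤ ≈ ⟦ i ⟧ℤ * ⟦ j ⟧ℤ
  ℤ-*-homo i (+ n)    = ℤ-*-homo-+ i n
  ℤ-*-homo i -[1+ n ] = begin
    ⟦ i ℤ.* -[1+ n ] ⟧ℤ             ≡⟨ ≡.cong ⟦_⟧ℤ (ℤ.neg-distribʳ-* i (+ suc n)) ⟨
    ⟦ ℤ.- (i ℤ.* (+ suc n)) ⟧ℤ      ≈⟨ ℤ-neg-homo (i ℤ.* (+ suc n)) ⟩
    - ⟦ i ℤ.* (+ suc n) ⟧ℤ          ≈⟨ -‿cong (ℤ-*-homo-+ i (suc n)) ⟩
    - (⟦ i ⟧ℤ * (suc n · 1#))       ≈⟨ -‿distribʳ-* _ _ ⟩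
    ⟦ i ⟧ℤ * - (suc n · 1#)         ∎

  ℤ-rawRing : RawRing _ _
  ℤ-rawRing = record
    { _≈_ = _≡_
    ; _+_ = ℤ._+_
    ; _*_ = ℤ._*_
    ; -_  = ℤ.-_
    ; 0#  = + 0
    ; 1#  = + 1
    }

  ℤ-homomorphism : ℤ-rawRing -Raw-AlmostCommutative⟶ fromCommutativeRing R
  ℤ-homomorphism = record
    { ⟦_⟧    = ⟦_⟧ℤ
    ; +-homo = ℤ-+-homo
    ; *-homo = ℤ-*-homo
    ; -‿homo = ℤ-neg-homo
    ; 0-homo = refl
    ; 1-homo = refl
    }

  -- Equality of the ring need not be decidable; the solver recognises cancelling terms by their
  -- integer coefficients.
  ≟-coefficients : ∀ i j → Maybe (⟦ i ⟧ℤ ≈ ⟦ j ⟧ℤ)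
  ≟-coefficients i j = map (reflexive ∘ ≡.cong ⟦_⟧ℤ) (dec⇒maybe (i ℤ.≟ j))

  open RingSolver ℤ-rawRing (fromCommutativeRing R) ℤ-homomorphism ≟-coefficients public
    using (solve; _:=_; _:+_; _:*_; _:-_; :-_; con)

-- Strict and weak order without trichotomy.

module RealNumbersProperties {c ℓ₁ ℓ₂} (ℝ : RealNumbers c ℓ₁ ℓ₂) where

  open RealNumbers ℝ
  open HeytingProperties (HeytingField.heytingCommutativeRing heytingField)
    using (invertibleˡ⇒#)
  open IntegerCoefficients commutativeRing
  open ≈-Reasoning setoid

  -- Stands in for trichotomy: apartness is cotransitive, and each apartness obtained gives one of
  -- the two inequalities, directly or by transitivity.
  <-cotrans : ∀ {x y} → x < y → ∀ z → x < z ⊎ z < y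
  <-cotrans {x} {y} x<y z
    with #-cotrans (Equivalence.from #⇔<⊎> (inj₁ x<y)) z
  ... | inj₁ x#z = [ inj₁ , (λ z<x → inj₂ (<-trans z<x x<y)) ]′ (Equivalence.to #⇔<⊎> x#z)
  ... | inj₂ z#y = [ inj₂ , (λ y<z → inj₁ (<-trans x<y y<z)) ]′ (Equivalence.to #⇔<⊎> z#y)

  <-≤-trans : ∀ {x y z} → x < y → y ≤ z → x < z
  <-≤-trans {z = z} x<y y≤z = [ id , ⊥-elim ∘ y≤z ]′ (<-cotrans x<y z)

  ≤-<-trans : ∀ {x y z} → x ≤ y → y < z → x < z
  ≤-<-trans {x = x} x≤y y<z = [ ⊥-elim ∘ x≤y , id ]′ (<-cotrans y<z x)

  -- Turns a non-negative, non-vanishing flow into a positive one.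
  ≤∧#⇒< : ∀ {x y} → x ≤ y → y # x → x < y
  ≤∧#⇒< x≤y y#x = [ ⊥-elim ∘ x≤y , id ]′ (Equivalence.to #⇔<⊎> y#x)

  ⊔-lub-< : ∀ {x y z} → x < z → y < z → x ⊔ y < z
  ⊔-lub-< {x} {y} {z} x<z y<z with <-cotrans x<z (x ⊔ y) | <-cotrans y<z (x ⊔ y)
  ... | inj₂ m<z | _        = m<z
  ... | inj₁ _   | inj₂ m<z = m<z
  -- Order is total up to double negation, so one of x, y is an upper bound.
  ... | inj₁ x<m | inj₁ y<m = ⊥-elim (x≰y λ y<x → y≰x λ x<y → <-irrefl refl (<-trans x<y y<x))
    where
    least = proj₂ (proj₂ (⊔-supremum x y))

    x≰y : ¬ (x ≤ y)
    x≰y x≤y = least y x≤y (<-irrefl refl) y<m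

    y≰x : ¬ (y ≤ x)
    y≰x y≤x = least x (<-irrefl refl) y≤x x<m

  y≤x⊔y : ∀ x y → y ≤ x ⊔ y
  y≤x⊔y x y = proj₁ (proj₂ (⊔-supremum x y))

  x<y⇒0<y-x : ∀ {x y} → x < y → 0# < y - x
  x<y⇒0<y-x {x} {y} x<y = <-respˡ-≈ (-‿inverseʳ x) (+-monoˡ-< (- x) x<y)

  0<y-x⇒x<y : ∀ {x y} → 0# < y - x → x < y
  0<y-x⇒x<y {x} {y} 0<y-x =
    <-respˡ-≈ (+-identityˡ x)
      (<-respʳ-≈ (solve 2 (λ x y → (y :- x) :+ x := y) refl x y) (+-monoˡ-< x 0<y-x))

  -- If `w` inverts `x * y`, then `w * x` inverts `y`, so `y` is apart from `0#`; and `y < 0#` would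
  -- make zero the sum of the positive terms `x * y` and `x * (0# - y)`.
  *-cancelˡ-pos : ∀ {x y} → 0# < x → 0# < x * y → 0# < y
  *-cancelˡ-pos {x} {y} 0<x 0<xy =
    [ (λ y<0 → ⊥-elim (y≮0 y<0)) , id ]′ (Equivalence.to #⇔<⊎> y#0)
    where
    xy-inverse = #⇒invertible (pos⇒#0 0<xy)
    w          = proj₁ xy-inverse

    y#0 : y # 0#
    y#0 = invertibleˡ⇒# (w * x , (begin
      w * x * (y - 0#)    ≈⟨ solve 3 (λ w x y →
                              w :* x :* (y :- con (+ 0)) := w :* (x :* y :- con (+ 0)))
                              refl w x y ⟩
      w * (x * y - 0#)    ≈⟨ proj₁ (proj₂ xy-inverse) ⟩
      1#                  ∎))

    y≮0 : ¬ (y < 0#)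
    y≮0 y<0 = <-irrefl refl (<-respʳ-≈
      (solve 2 (λ x y → x :* y :+ x :* (con (+ 0) :- y) := con (+ 0)) refl x y)
      (+-pos 0<xy (*-pos 0<x (x<y⇒0<y-x y<0))))

  *-/-cancel : ∀ x y z (0<y : 0# < y) → y * (z - x / y [ 0<y ]) ≈ z * y - x
  *-/-cancel x y z 0<y = begin
    y * (z - x * w)              ≈⟨ solve 4 (λ x y z w →
                                       y :* (z :- x :* w)
                                       := z :* y :- x :* (w :* (y :- con (+ 0))))
                                       refl x y z w ⟩
    -- The inverse law for `w` is stated for `y - 0#`, hence the extra subtraction of zero.
    z * y - x * (w * (y - 0#))   ≈⟨ +-congˡ (-‿cong (*-congˡ (proj₁ (proj₂ y-inverse)))) ⟩
    z * y - x * 1#               ≈⟨ +-congˡ (-‿cong (*-identityʳ x)) ⟩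
    z * y - x                    ∎
    where
    y-inverse = #⇒invertible (pos⇒#0 0<y)
    w         = proj₁ y-inverse

  -- Clears the positive denominator, so that a bound on `Q` becomes a sign condition on a
  -- difference supplied by the flow equations.
  /-<⇔ : ∀ {x y z} (0<y : 0# < y) → x / y [ 0<y ] < z ⇔ 0# < z * y - x
  /-<⇔ {x} {y} {z} 0<y = mk⇔
    (λ x/y<z → <-respʳ-≈ (*-/-cancel x y z 0<y) (*-pos 0<y (x<y⇒0<y-x x/y<z)))
    (λ 0<zy-x → 0<y-x⇒x<y (*-cancelˡ-pos 0<y (<-respʳ-≈ (sym (*-/-cancel x y z 0<y)) 0<zy-x)))

-- Linear equations for two routes sharing a total flow.

module NetworkEquilibria {c ℓ₁ ℓ₂} (ℝ : RealNumbers c ℓ₁ ℓ₂) where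

  open RealNumbers ℝ
  open RealNumbersProperties ℝ
  open IntegerCoefficients commutativeRing
  open Braess ℝ
  open ≈-Reasoning setoid

  -- For two flows of total `q` whose affine costs agree, with `δ` the gap between the constants,
  -- eliminating `f` determines `g` without division.
  balance : ∀ {f g q u v δ} → f + g ≈ q → u * f ≈ δ + v * g →
            (u + v) * g ≈ q * u - δ
  balance {f} {g} {q} {u} {v} {δ} f+g≈q uf≈δ+vg = begin
    (u + v) * g               ≈⟨ solve 4 (λ g u v δ → (u :+ v) :* g := (δ :+ v :* g) :+ u :* g :- δ) refl g u v δ ⟩
    (δ + v * g) + u * g - δ   ≈⟨ +-congʳ (+-congʳ uf≈δ+vg) ⟨
    u * f + u * g - δ         ≈⟨ solve 4 (λ f g u δ → u :* f :+ u :* g :- δ := (f :+ g) :* u :- δ) refl f g u δ ⟩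
    (f + g) * u - δ           ≈⟨ +-congʳ (*-congʳ f+g≈q) ⟩
    q * u - δ                 ∎

  -- Swaps the two routes, negating `δ`, so that `balance` also yields the other flow.
  transpose : ∀ {x y δ} → x ≈ δ + y → y ≈ - δ + x
  transpose {x} {y} {δ} x≈δ+y = begin
    y               ≈⟨ solve 2 (λ y δ → y := :- δ :+ (δ :+ y)) refl y δ ⟩
    - δ + (δ + y)   ≈⟨ +-congˡ x≈δ+y ⟨
    - δ + x         ∎

  equal-times : ∀ {t a b x y} → t ≈ a + x → t ≈ b + y → x ≈ (b - a) + y
  equal-times {t} {a} {b} {x} {y} t≈a+x t≈b+y = begin
    x               ≈⟨ solve 2 (λ a x → x := (a :+ x) :- a) refl a x ⟩
    (a + x) - a     ≈⟨ +-congʳ t≈a+x ⟨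
    t - a           ≈⟨ +-congʳ t≈b+y ⟩
    (b + y) - a     ≈⟨ solve 3 (λ a b y → (b :+ y) :- a := (b :- a) :+ y) refl a b y ⟩
    (b - a) + y     ∎

  -- Flows and path times at the two equilibria.

  module OnlyP₁Vanishes
    (params : Parameters)
    (E : Equilibrium params N) (E⁺ : Equilibrium params N⁺)
    (noVanishing : NoVanishingPath params E)
    (onlyP₁Vanishing : OnlyVanishingPath params E⁺ P₁) where

    open Notation params
    open Parameters params using (slope>0)
    module E = Equilibrium E
    module E⁺ = Equilibrium E⁺

    T T⁺ T₁⁺ f₁ f₂ g₂ g₃ : Carrier
    T   = E.time
    T⁺  = E⁺.time
    T₁⁺ = E⁺.pathTime P₁
    f₁  = E.flow P₁
    f₂  = E.flow P₂
    g₂  = E⁺.flow P₂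
    g₃  = E⁺.flow P₃

    0<f : ∀ p → 0# < E.flow p
    0<f p = ≤∧#⇒< (E.flow≥0 p) (noVanishing p)

    0<g : ∀ p → p ≢ P₁ → 0# < E⁺.flow p
    0<g p p≢P₁ = ≤∧#⇒< (E⁺.flow≥0 p) (proj₂ onlyP₁Vanishing p p≢P₁)

    g₁≈0 : E⁺.flow P₁ ≈ 0#
    g₁≈0 = proj₁ onlyP₁Vanishing

    f₁+f₂≈Q : f₁ + f₂ ≈ Q
    f₁+f₂≈Q = trans (+-congˡ (sym (+-identityʳ f₂))) E.total

    -- The left side is what `E⁺.linkFlow cd` computes to: as `P₁` is empty, all traffic crosses
    -- this link.
    g₂+[g₃+0]≈Q : g₂ + (g₃ + 0#) ≈ Q
    g₂+[g₃+0]≈Q = begin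
      g₂ + (g₃ + 0#)                    ≈⟨ +-identityˡ _ ⟨
      0# + (g₂ + (g₃ + 0#))             ≈⟨ +-congʳ g₁≈0 ⟨
      E⁺.flow P₁ + (g₂ + (g₃ + 0#))     ≈⟨ E⁺.total ⟩
      Q                                 ∎

    g₃+g₂≈Q : g₃ + g₂ ≈ Q
    g₃+g₂≈Q = trans (solve 2 (λ x y → x :+ y := y :+ (x :+ con (+ 0))) refl g₃ g₂) g₂+[g₃+0]≈Q

    g₁+[g₃+0]≈g₃ : E⁺.flow P₁ + (g₃ + 0#) ≈ g₃
    g₁+[g₃+0]≈g₃ = trans (+-cong g₁≈0 (+-identityʳ g₃)) (+-identityˡ g₃)

    linkFlow-bd≈0 : E⁺.linkFlow bd ≈ 0#
    linkFlow-bd≈0 = trans (+-identityʳ _) g₁≈0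

    T≈P₁ : T ≈ α₁₂ + β₁₂ * f₁
    T≈P₁ = begin
      T                ≈⟨ E.nonVanishing-time P₁ (noVanishing P₁) ⟨
      -- The filter over `∈?` evaluates, so this path time is definitionally the polynomial given to
      -- the solver.
      E.pathTime P₁    ≈⟨ solve 5 (λ a b u v f →
                            (a :+ u :* (f :+ con (+ 0))) :+ ((b :+ v :* (f :+ con (+ 0))) :+ con (+ 0))
                            := (a :+ b) :+ (u :+ v) :* f) refl α₁ α₂ β₁ β₂ f₁ ⟩
      α₁₂ + β₁₂ * f₁   ∎

    T≈P₂ : T ≈ α₄₅ + β₄₅ * f₂
    T≈P₂ = begin
      T                ≈⟨ E.nonVanishing-time P₂ (noVanishing P₂) ⟨
      E.pathTime P₂    ≈⟨ solve 5 (λ a b u v f →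
                            (a :+ u :* (f :+ con (+ 0))) :+ ((b :+ v :* (f :+ con (+ 0))) :+ con (+ 0))
                            := (a :+ b) :+ (u :+ v) :* f) refl α₄ α₅ β₄ β₅ f₂ ⟩
      α₄₅ + β₄₅ * f₂   ∎

    -- The time `α₅ + β₅ * Q` of the link `cd` is kept as one summand, because it is common to both
    -- used paths and drops out when they are compared.
    T⁺≈P₂ : T⁺ ≈ (α₅ + β₅ * Q) + α₄ + β₄ * g₂
    T⁺≈P₂ = begin
      T⁺                                ≈⟨ E⁺.nonVanishing-time P₂ (proj₂ onlyP₁Vanishing P₂ λ ()) ⟨
      E⁺.pathTime P₂                    ≈⟨ +-congˡ (+-congʳ (+-congˡ (*-congˡ g₂+[g₃+0]≈Q))) ⟩
      (α₄ + β₄ * (g₂ + 0#)) + ((α₅ + β₅ * Q) + 0#)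
                                        ≈⟨ solve 4 (λ a u g t → (a :+ u :* (g :+ con (+ 0))) :+ (t :+ con (+ 0))
                                                     := t :+ a :+ u :* g) refl α₄ β₄ g₂ (α₅ + β₅ * Q) ⟩
      (α₅ + β₅ * Q) + α₄ + β₄ * g₂      ∎

    T⁺≈P₃ : T⁺ ≈ (α₅ + β₅ * Q) + α₁₃ + β₁₃ * g₃
    T⁺≈P₃ = begin
      T⁺                                ≈⟨ E⁺.nonVanishing-time P₃ (proj₂ onlyP₁Vanishing P₃ λ ()) ⟨
      E⁺.pathTime P₃                    ≈⟨ +-cong (+-congˡ (*-congˡ g₁+[g₃+0]≈g₃))
                                             (+-congˡ (+-congʳ (+-congˡ (*-congˡ g₂+[g₃+0]≈Q)))) ⟩
      (α₁ + β₁ * g₃) + ((α₃ + β₃ * (g₃ + 0#)) + ((α₅ + β₅ * Q) + 0#))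
                                        ≈⟨ solve 6 (λ a b u v g t →
                                             (a :+ u :* g) :+ ((b :+ v :* (g :+ con (+ 0))) :+ (t :+ con (+ 0)))
                                             := t :+ (a :+ b) :+ (u :+ v) :* g)
                                             refl α₁ α₃ β₁ β₃ g₃ (α₅ + β₅ * Q) ⟩
      (α₅ + β₅ * Q) + α₁₃ + β₁₃ * g₃    ∎

    T₁⁺≈ : T₁⁺ ≈ α₁₂ + β₁ * g₃
    T₁⁺≈ = begin
      T₁⁺                       ≈⟨ +-cong (+-congˡ (*-congˡ g₁+[g₃+0]≈g₃))
                                     (+-congʳ (+-congˡ (*-congˡ linkFlow-bd≈0))) ⟩
      (α₁ + β₁ * g₃) + ((α₂ + β₂ * 0#) + 0#)
                                ≈⟨ solve 5 (λ a b u v g →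
                                     (a :+ u :* g) :+ ((b :+ v :* con (+ 0)) :+ con (+ 0))
                                     := (a :+ b) :+ u :* g) refl α₁ α₂ β₁ β₂ g₃ ⟩
      α₁₂ + β₁ * g₃             ∎

    T⁺≤T₁⁺ : T⁺ ≤ T₁⁺
    T⁺≤T₁⁺ = E⁺.vanishing-time P₁ g₁≈0

    -- Lower bounds on `Q` from positive flows.

    β₁₂f₁≈α+β₄₅f₂ : β₁₂ * f₁ ≈ α + β₄₅ * f₂
    β₁₂f₁≈α+β₄₅f₂ = equal-times T≈P₁ T≈P₂

    -- After the common link `cd` cancels, `P₂` and `P₃` compete as two routes from a to c, with
    -- constants `α₄` and `α₁₃`.
    β₁₃g₃≈ᾱ+β₄g₂ : β₁₃ * g₃ ≈ ᾱ + β₄ * g₂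
    β₁₃g₃≈ᾱ+β₄g₂ = trans (equal-times T⁺≈P₃ T⁺≈P₂) (+-congʳ
      (solve 3 (λ t a b → (t :+ a) :- (t :+ b) := a :- b) refl (α₅ + β₅ * Q) α₄ α₁₃))

    f₂-balance : (β₁₂ + β₄₅) * f₂ ≈ Q * β₁₂ - α
    f₂-balance = balance f₁+f₂≈Q β₁₂f₁≈α+β₄₅f₂

    f₁-balance : (β₄₅ + β₁₂) * f₁ ≈ Q * β₄₅ - - α
    f₁-balance = balance (trans (+-comm f₂ f₁) f₁+f₂≈Q) (transpose β₁₂f₁≈α+β₄₅f₂)

    g₂-balance : (β₁₃ + β₄) * g₂ ≈ Q * β₁₃ - ᾱ
    g₂-balance = balance g₃+g₂≈Q β₁₃g₃≈ᾱ+β₄g₂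

    g₃-balance : (β₄ + β₁₃) * g₃ ≈ Q * β₄ - - ᾱ
    g₃-balance = balance (trans (+-comm g₂ g₃) g₃+g₂≈Q) (transpose β₁₃g₃≈ᾱ+β₄g₂)

    α/β₁₂<Q : α / β₁₂ [ 0<β₁₂ ] < Q
    α/β₁₂<Q = Equivalence.from (/-<⇔ 0<β₁₂)
      (<-respʳ-≈ f₂-balance (*-pos (+-pos 0<β₁₂ 0<β₄₅) (0<f P₂)))

    -α/β₄₅<Q : (- α) / β₄₅ [ 0<β₄₅ ] < Q
    -α/β₄₅<Q = Equivalence.from (/-<⇔ 0<β₄₅)
      (<-respʳ-≈ f₁-balance (*-pos (+-pos 0<β₄₅ 0<β₁₂) (0<f P₁)))

    ᾱ/β₁₃<Q : ᾱ / β₁₃ [ 0<β₁₃ ] < Q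
    ᾱ/β₁₃<Q = Equivalence.from (/-<⇔ 0<β₁₃)
      (<-respʳ-≈ g₂-balance (*-pos (+-pos 0<β₁₃ 0<β₄) (0<g P₂ λ ())))

    -ᾱ/β₄<Q : (- ᾱ) / β₄ [ 0<β₄ ] < Q
    -ᾱ/β₄<Q = Equivalence.from (/-<⇔ 0<β₄)
      (<-respʳ-≈ g₃-balance (*-pos (+-pos 0<β₄ 0<β₁₃) (0<g P₃ λ ())))

    -- The difference of the equilibrium times.

    0<β₁₃₄ : 0# < β₁₃₄
    0<β₁₃₄ = +-pos 0<β₁₃ 0<β₄

    0<β : 0# < β
    0<β = +-pos (+-pos 0<β₁₂ 0<β₄) (slope>0 cd)

    -- Both times are read along `P₂`, so that the constants cancel.
    T⁺-T≈ : T⁺ - T ≈ β₅ * Q + β₄ * g₂ - β₄₅ * f₂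
    T⁺-T≈ = begin
      T⁺ - T
        ≈⟨ +-cong T⁺≈P₂ (-‿cong T≈P₂) ⟩
      (α₅ + β₅ * Q) + α₄ + β₄ * g₂ - (α₄₅ + β₄₅ * f₂)
        ≈⟨ solve 5 (λ a b x y z → (b :+ x) :+ a :+ y :- ((a :+ b) :+ z) := x :+ y :- z)
             refl α₄ α₅ (β₅ * Q) (β₄ * g₂) (β₄₅ * f₂) ⟩
      β₅ * Q + β₄ * g₂ - β₄₅ * f₂
        ∎

    C : Carrier
    C = ᾱ * β₄ * β - α * β₁₃₄ * β₄₅

    -- The factors `β` and `β₁₃₄` are the sums of slopes that multiply `f₂` and `g₂` in their
    -- balances, so both flows can be eliminated without division.
    ββ₁₃₄[T⁺-T]≈Q𝓑₃-C : β * β₁₃₄ * (T⁺ - T) ≈ Q * 𝓑₃ - C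
    ββ₁₃₄[T⁺-T]≈Q𝓑₃-C = begin
      β * β₁₃₄ * (T⁺ - T)
        ≈⟨ *-congˡ T⁺-T≈ ⟩
      β * β₁₃₄ * (β₅ * Q + β₄ * g₂ - β₄₅ * f₂)
        ≈⟨ solve 8 (λ b₁ b₂ b₃ b₄ b₅ q g f →
             let b = b₁ :+ b₂ :+ b₄ :+ b₅ ; b₁₃₄ = b₁ :+ b₃ :+ b₄ in
             b :* b₁₃₄ :* (b₅ :* q :+ b₄ :* g :- (b₄ :+ b₅) :* f)
             := b :* b₁₃₄ :* b₅ :* q :+ b :* b₄ :* ((b₁ :+ b₃ :+ b₄) :* g)
                :- b₁₃₄ :* (b₄ :+ b₅) :* ((b₁ :+ b₂ :+ (b₄ :+ b₅)) :* f))
             refl β₁ β₂ β₃ β₄ β₅ Q g₂ f₂ ⟩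
      β * β₁₃₄ * β₅ * Q + β * β₄ * ((β₁₃ + β₄) * g₂) - β₁₃₄ * β₄₅ * ((β₁₂ + β₄₅) * f₂)
        ≈⟨ +-cong (+-congˡ (*-congˡ g₂-balance)) (-‿cong (*-congˡ f₂-balance)) ⟩
      β * β₁₃₄ * β₅ * Q + β * β₄ * (Q * β₁₃ - ᾱ) - β₁₃₄ * β₄₅ * (Q * β₁₂ - α)
        ≈⟨ solve 8 (λ b₁ b₂ b₃ b₄ b₅ q ā a →
             let b = b₁ :+ b₂ :+ b₄ :+ b₅ ; b₁₃₄ = b₁ :+ b₃ :+ b₄ ; b₄₅ = b₄ :+ b₅ in
             b :* b₁₃₄ :* b₅ :* q :+ b :* b₄ :* (q :* (b₁ :+ b₃) :- ā)
               :- b₁₃₄ :* b₄₅ :* (q :* (b₁ :+ b₂) :- a)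
             := q :* (b₄₅ :* b₄₅ :* b₁₃₄ :- b₄ :* b₄ :* b)
                :- (ā :* b₄ :* b :- a :* b₁₃₄ :* b₄₅))
             refl β₁ β₂ β₃ β₄ β₅ Q ᾱ α ⟩
      Q * 𝓑₃ - C
        ∎

    T⁺-T₁⁺≈ : T⁺ - T₁⁺ ≈ β₅ * Q + β₃ * g₃ - α̂
    T⁺-T₁⁺≈ = begin
      T⁺ - T₁⁺
        -- `T⁺` is read along `P₃`, which shares the link `ab` with `P₁`, so the terms in `β₁`
        -- cancel.
        ≈⟨ +-cong T⁺≈P₃ (-‿cong T₁⁺≈) ⟩
      (α₅ + β₅ * Q) + α₁₃ + β₁₃ * g₃ - (α₁₂ + β₁ * g₃)
        ≈⟨ solve 8 (λ a₁ a₂ a₃ a₅ x b₁ b₃ g →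
             (a₅ :+ x) :+ (a₁ :+ a₃) :+ (b₁ :+ b₃) :* g :- ((a₁ :+ a₂) :+ b₁ :* g)
             := x :+ b₃ :* g :- (a₂ :- (a₃ :+ a₅)))
             refl α₁ α₂ α₃ α₅ (β₅ * Q) β₁ β₃ g₃ ⟩
      β₅ * Q + β₃ * g₃ - α̂
        ∎

    -- The balance of `g₃` brings in `ᾱ`, while `μ₁` is written with `α` and `α̂`; this relation
    -- translates.
    α≈ᾱ-α̂ : α ≈ ᾱ - α̂
    α≈ᾱ-α̂ = solve 5 (λ a₁ a₂ a₃ a₄ a₅ →
      (a₄ :+ a₅) :- (a₁ :+ a₂) := (a₄ :- (a₁ :+ a₃)) :- (a₂ :- (a₃ :+ a₅)))
      refl α₁ α₂ α₃ α₄ α₅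

    β₁₃₄[T⁺-T₁⁺]≈ :
      β₁₃₄ * (T⁺ - T₁⁺) ≈ Q * (β₃ * β₄₅ + β₅ * β₁₄) - (α̂ * β₁₄ - α * β₃)
    β₁₃₄[T⁺-T₁⁺]≈ = begin
      β₁₃₄ * (T⁺ - T₁⁺)
        ≈⟨ *-congˡ T⁺-T₁⁺≈ ⟩
      β₁₃₄ * (β₅ * Q + β₃ * g₃ - α̂)
        ≈⟨ solve 7 (λ b₁ b₃ b₄ b₅ q g â →
             (b₁ :+ b₃ :+ b₄) :* (b₅ :* q :+ b₃ :* g :- â)
             := (b₁ :+ b₃ :+ b₄) :* (b₅ :* q :- â) :+ b₃ :* ((b₄ :+ (b₁ :+ b₃)) :* g))
             refl β₁ β₃ β₄ β₅ Q g₃ α̂ ⟩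
      β₁₃₄ * (β₅ * Q - α̂) + β₃ * ((β₄ + β₁₃) * g₃)
        ≈⟨ +-congˡ (*-congˡ g₃-balance) ⟩
      β₁₃₄ * (β₅ * Q - α̂) + β₃ * (Q * β₄ - - ᾱ)
        ≈⟨ solve 7 (λ b₁ b₃ b₄ b₅ q ā â →
             (b₁ :+ b₃ :+ b₄) :* (b₅ :* q :- â) :+ b₃ :* (q :* b₄ :- :- ā)
             := q :* (b₃ :* (b₄ :+ b₅) :+ b₅ :* (b₁ :+ b₄)) :- (â :* (b₁ :+ b₄) :- (ā :- â) :* b₃))
             refl β₁ β₃ β₄ β₅ Q ᾱ α̂ ⟩
      Q * (β₃ * β₄₅ + β₅ * β₁₄) - (α̂ * β₁₄ - (ᾱ - α̂) * β₃)
        ≈⟨ +-congˡ (-‿cong (+-congˡ (-‿cong (*-congʳ α≈ᾱ-α̂)))) ⟨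
      Q * (β₃ * β₄₅ + β₅ * β₁₄) - (α̂ * β₁₄ - α * β₃)
        ∎

    -- Were `Q` above `μ₁`, the empty path `P₁` would be faster than the used ones.
    Q≤μ₁ : Q ≤ μ₁
    Q≤μ₁ μ₁<Q = T⁺≤T₁⁺ (0<y-x⇒x<y (*-cancelˡ-pos 0<β₁₃₄
      (<-respʳ-≈ (sym β₁₃₄[T⁺-T₁⁺]≈) (Equivalence.to (/-<⇔ 0<β₃β₄₅+β₅β₁₄) μ₁<Q))))

    -- Positivity of `𝓑₃` under the paradox.

    T₁⁺-T≈ : T₁⁺ - T ≈ β₁ * g₃ - β₁₂ * f₁
    T₁⁺-T≈ = trans (+-cong T₁⁺≈ (-‿cong T≈P₁))
      (solve 3 (λ a x y → (a :+ x) :- (a :+ y) := x :- y) refl α₁₂ (β₁ * g₃) (β₁₂ * f₁))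

    g₃≈f₁+f₂-g₂ : g₃ ≈ f₁ + f₂ - g₂
    g₃≈f₁+f₂-g₂ = begin
      g₃               ≈⟨ solve 2 (λ x y → x := (x :+ y) :- y) refl g₃ g₂ ⟩
      g₃ + g₂ - g₂     ≈⟨ +-congʳ (trans g₃+g₂≈Q (sym f₁+f₂≈Q)) ⟩
      f₁ + f₂ - g₂     ∎

    -- The weights `β₁` and `β₄` are chosen so that both `g₂` and `f₂` cancel, leaving a multiple of
    -- `f₁` alone.
    β₁[T⁺-T]+β₄[T₁⁺-T]≈ : β₁ * (T⁺ - T) + β₄ * (T₁⁺ - T) ≈ f₁ * (β₁ * β₅ - β₂ * β₄)
    β₁[T⁺-T]+β₄[T₁⁺-T]≈ = begin
      β₁ * (T⁺ - T) + β₄ * (T₁⁺ - T)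
        ≈⟨ +-cong
             (*-congˡ (trans T⁺-T≈ (+-congʳ (+-congʳ (*-congˡ (sym f₁+f₂≈Q))))))
             (*-congˡ (trans T₁⁺-T≈ (+-congʳ (*-congˡ g₃≈f₁+f₂-g₂)))) ⟩
      β₁ * (β₅ * (f₁ + f₂) + β₄ * g₂ - β₄₅ * f₂) + β₄ * (β₁ * (f₁ + f₂ - g₂) - β₁₂ * f₁)
        ≈⟨ solve 7 (λ b₁ b₂ b₄ b₅ f₁ f₂ g →
             b₁ :* (b₅ :* (f₁ :+ f₂) :+ b₄ :* g :- (b₄ :+ b₅) :* f₂)
               :+ b₄ :* (b₁ :* (f₁ :+ f₂ :- g) :- (b₁ :+ b₂) :* f₁)
             := f₁ :* (b₁ :* b₅ :- b₂ :* b₄))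
             refl β₁ β₂ β₄ β₅ f₁ f₂ g₂ ⟩
      f₁ * (β₁ * β₅ - β₂ * β₄)
        ∎

    -- Expanding the square in `𝓑₃` gives `β₄ * β₅` the coefficient twice `β₁₃₄`; lending `β₁` to
    -- the first bracket and absorbing `- β₄ * β₄ * β₅` leaves `β₁₃₄ + β₃`.
    𝓑₃≈ : β₄ * (β₁ * β₅ - β₂ * β₄)
            + (β₄ * β₄ * β₃ + β₄ * β₅ * (β₁₃₄ + β₃) + β₅ * β₅ * β₁₃₄) ≈ 𝓑₃
    𝓑₃≈ = solve 5 (λ b₁ b₂ b₃ b₄ b₅ →
      b₄ :* (b₁ :* b₅ :- b₂ :* b₄)
        :+ (b₄ :* b₄ :* b₃ :+ b₄ :* b₅ :* (b₁ :+ b₃ :+ b₄ :+ b₃) :+ b₅ :* b₅ :* (b₁ :+ b₃ :+ b₄))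
      := (b₄ :+ b₅) :* (b₄ :+ b₅) :* (b₁ :+ b₃ :+ b₄) :- b₄ :* b₄ :* (b₁ :+ b₂ :+ b₄ :+ b₅))
      refl β₁ β₂ β₃ β₄ β₅

    paradox⇒0<𝓑₃ : T < T⁺ → 0# < 𝓑₃
    paradox⇒0<𝓑₃ T<T⁺ = <-respʳ-≈ 𝓑₃≈
      (+-pos (*-pos 0<β₄ 0<β₁β₅-β₂β₄)
        (+-pos (+-pos (*-pos (*-pos 0<β₄ 0<β₄) 0<β₃)
                      (*-pos (*-pos 0<β₄ 0<β₅) (+-pos 0<β₁₃₄ 0<β₃)))
               (*-pos (*-pos 0<β₅ 0<β₅) 0<β₁₃₄)))
      where
      0<β₃ = slope>0 bc
      0<β₅ = slope>0 cd

      0<β₁β₅-β₂β₄ : 0# < β₁ * β₅ - β₂ * β₄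
      0<β₁β₅-β₂β₄ = *-cancelˡ-pos (0<f P₁) (<-respʳ-≈ β₁[T⁺-T]+β₄[T₁⁺-T]≈
        (+-pos (*-pos (slope>0 ab) (x<y⇒0<y-x T<T⁺))
               (*-pos 0<β₄ (x<y⇒0<y-x (<-≤-trans T<T⁺ T⁺≤T₁⁺)))))

    -- Equivalence of the paradox with the bounds on `Q`.

    paradox⇔C/𝓑₃<Q : (0<𝓑₃ : 0# < 𝓑₃) → T < T⁺ ⇔ C / 𝓑₃ [ 0<𝓑₃ ] < Q
    paradox⇔C/𝓑₃<Q 0<𝓑₃ = mk⇔
      (λ T<T⁺ → Equivalence.from (/-<⇔ 0<𝓑₃)
        (<-respʳ-≈ ββ₁₃₄[T⁺-T]≈Q𝓑₃-C (*-pos (*-pos 0<β 0<β₁₃₄) (x<y⇒0<y-x T<T⁺))))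
      (λ C/𝓑₃<Q → 0<y-x⇒x<y (*-cancelˡ-pos (*-pos 0<β 0<β₁₃₄)
        (<-respʳ-≈ (sym ββ₁₃₄[T⁺-T]≈Q𝓑₃-C) (Equivalence.to (/-<⇔ 0<𝓑₃) C/𝓑₃<Q))))

    -- The proof of `0# < 𝓑₃` is an argument because the last quotient is formed only for a positive
    -- denominator.
    lowerBound : 0# < 𝓑₃ → Carrier
    lowerBound 0<𝓑₃ =
      (α / β₁₂ [ 0<β₁₂ ])
      ⊔ ((- α) / β₄₅ [ 0<β₄₅ ])
      ⊔ (ᾱ / β₁₃ [ 0<β₁₃ ])
      ⊔ ((- ᾱ) / β₄ [ 0<β₄ ])
      ⊔ (C / 𝓑₃ [ 0<𝓑₃ ])

    BoundsOnQ : Set ℓ₂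
    BoundsOnQ = Σ[ 0<𝓑₃ ∈ 0# < 𝓑₃ ] (lowerBound 0<𝓑₃ < Q × Q ≤ μ₁)

    paradox⇒bounds : T < T⁺ → BoundsOnQ
    paradox⇒bounds T<T⁺ =
      0<𝓑₃ ,
      -- The first four entries lie below `Q` because the used flows are positive; for the fifth
      -- this is equivalent to the paradox.
      ⊔-lub-< (⊔-lub-< (⊔-lub-< (⊔-lub-< α/β₁₂<Q -α/β₄₅<Q) ᾱ/β₁₃<Q) -ᾱ/β₄<Q)
        (Equivalence.to (paradox⇔C/𝓑₃<Q 0<𝓑₃) T<T⁺) ,
      Q≤μ₁
      where
      0<𝓑₃ = paradox⇒0<𝓑₃ T<T⁺

    bounds⇒paradox : BoundsOnQ → T < T⁺
    bounds⇒paradox (0<𝓑₃ , lowerBound<Q , _) =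
      Equivalence.from (paradox⇔C/𝓑₃<Q 0<𝓑₃)
        -- Joins nest to the left, so the last quotient is the right argument of the outermost `⊔`.
        (≤-<-trans (y≤x⊔y _ (C / 𝓑₃ [ 0<𝓑₃ ])) lowerBound<Q)

theorem3 :
  ∀ {c ℓ₁ ℓ₂} (ℝ : RealNumbers c ℓ₁ ℓ₂) →
  let open RealNumbers ℝ
      open Braess ℝ in
  (params : Parameters) →
  let open Notation params in
  (E : Equilibrium params N) (E⁺ : Equilibrium params N⁺) →
  NoVanishingPath params E →
  OnlyVanishingPath params E⁺ P₁ →
  BraessParadox params E E⁺ ⇔
    (Σ[ 0<𝓑₃ ∈ 0# < 𝓑₃ ]
      ( (α / β₁₂ [ 0<β₁₂ ])
        ⊔ ((- α) / β₄₅ [ 0<β₄₅ ])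
        ⊔ (ᾱ / β₁₃ [ 0<β₁₃ ])
        ⊔ ((- ᾱ) / β₄ [ 0<β₄ ])
        ⊔ ((ᾱ * β₄ * β - α * β₁₃₄ * β₄₅) / 𝓑₃ [ 0<𝓑₃ ])
        < Q
      × Q ≤ μ₁ ))
theorem3 ℝ params E E⁺ noVanishing onlyP₁Vanishing =
  mk⇔ paradox⇒bounds bounds⇒paradox
  where
  open NetworkEquilibria.OnlyP₁Vanishes ℝ params E E⁺ noVanishing onlyP₁Vanishing
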